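{- Let $G_1,G_2,G_3,G_4$ be the following ordered matchings: $G_1$ on vertex set $[8]$ with edges $\{1,3\},\{2,7\},\{4,5\},\{6,8\}$; $G_2$ on vertex set $[10]$ with edges $\{1,5\},\{2,3\},\{4,7\},\{6,10\},\{8,9\}$; $G_3$ on vertex set $[10]$ with edges $\{1,5\},\{2,3\},\{4,9\},\{6,7\},\{8,10\}$; $G_4$ on vertex set $[10]$ with edges $\{1,3\},\{2,7\},\{4,5\},\{6,10\},\{8,9\}$. Then $sat_{<}(n,G_i)=O(1)$ for each $i=1,2,3,4$.
   Context: An ordered graph is a finite simple graph whose vertex set is linearly ordered (identified with $[m]$ with the natural order). An ordered graph $H$ contains an ordered graph $G$ if there is an injective order-preserving map $\varphi:V(G)\to V(H)$ with $\varphi(u)\varphi(v)\in E(H)$ for all $uv\in E(G)$; otherwise $H$ avoids $G$. $H$ saturates $G$ if $H$ avoids $G$ but adding any non-edge to $H$ yields a graph containing $G$. $sat_{<}(n,G)$ is the minimum number of edges of an ordered graph on $n$ vertices saturating $G$. (In the paper's notation $G_1,G_2,G_3,G_4$ are the linked matchings $\Gamma_{\{0,1,0\}},\Gamma_{\{1,0,1\}},\Gamma_{\{1,1,0\}},\Gamma_{\{0,1,1\}}$.) -}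

module Defs where

open import Data.Nat using (ℕ; zero; suc; _+_; _≤_)
open import Data.Fin using (Fin; toℕ; _<_; _≟_)
open import Data.Bool using (Bool; true; false; _∨_; _∧_; if_then_else_)
open import Data.Product using (Σ; _×_; _,_; ∃; ∃-syntax)
open import Data.List using (List; []; _∷_; filter; length; allFin; concatMap; map)
open import Relation.Binary.PropositionalEquality using (_≡_)
open import Relation.Nullary using (¬_; Dec; yes; no)
open import Relation.Nullary.Decidable using (⌊_⌋)
import Data.Fin as F

-- An ordered graph on vertex set Fin n (= [n] with natural order):
-- a symmetric, irreflexive Boolean adjacency relation.
record OGraph (n : ℕ) : Set where
  field
    adj   : Fin n → Fin n → Bool
    sym   : ∀ u v → adj u v ≡ adj v u
    irrefl : ∀ u → adj u u ≡ false
open OGraph public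

edgeCount : ∀ {n} → OGraph n → ℕ
edgeCount {n} H =
  length (filter (λ p → Data.Bool._≟_ (adj H (Data.Product.proj₁ p) (Data.Product.proj₂ p) ∧ ⌊ Data.Product.proj₁ p F.<? Data.Product.proj₂ p ⌋) true)
    (concatMap (λ u → map (λ v → (u , v)) (allFin n)) (allFin n)))

Contains : ∀ {n m} → OGraph n → OGraph m → Set
Contains {n} {m} H G =
  Σ (Fin m → Fin n) λ φ →
    (∀ u v → u < v → φ u < φ v) ×
    (∀ u v → adj G u v ≡ true → adj H (φ u) (φ v) ≡ true)

Avoids : ∀ {n m} → OGraph n → OGraph m → Set
Avoids H G = ¬ Contains H G

addEdge : ∀ {n} → OGraph n → (i j : Fin n) → i < j → OGraph n
addEdge {n} H i j i<j = record
  { adj = a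
  ; sym = s
  ; irrefl = ir
  }
  where
  isij : Fin n → Fin n → Bool
  isij u v = (⌊ u ≟ i ⌋ ∧ ⌊ v ≟ j ⌋) ∨ (⌊ u ≟ j ⌋ ∧ ⌊ v ≟ i ⌋)
  a : Fin n → Fin n → Bool
  a u v = adj H u v ∨ isij u v
  open import Relation.Binary.PropositionalEquality using (refl; cong₂; trans; sym)
  open import Data.Bool.Properties using (∨-comm)
  isij-sym : ∀ u v → isij u v ≡ isij v u
  isij-sym u v = trans (∨-comm (⌊ u ≟ i ⌋ ∧ ⌊ v ≟ j ⌋) (⌊ u ≟ j ⌋ ∧ ⌊ v ≟ i ⌋))
    (cong₂ _∨_ (Data.Bool.Properties.∧-comm ⌊ u ≟ j ⌋ ⌊ v ≟ i ⌋) (Data.Bool.Properties.∧-comm ⌊ u ≟ i ⌋ ⌊ v ≟ j ⌋))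
  s : ∀ u v → a u v ≡ a v u
  s u v = cong₂ _∨_ (OGraph.sym H u v) (isij-sym u v)
  ir : ∀ u → a u u ≡ false
  ir u with u ≟ i | u ≟ j
  ... | no _ | no _ rewrite irrefl H u = refl
  ... | yes refl | yes refl = Data.Empty.⊥-elim (Data.Nat.Properties.<-irrefl refl i<j)
    where import Data.Empty; import Data.Nat.Properties
  ... | yes refl | no _ rewrite irrefl H u = refl
  ... | no _ | yes refl rewrite irrefl H u = refl

Saturates : ∀ {n m} → OGraph n → OGraph m → Set
Saturates {n} H G =
  Avoids H G ×
  (∀ (i j : Fin n) (i<j : i < j) → adj H i j ≡ false → Contains (addEdge H i j i<j) G)

-- sat_<(n,G) ≤ C : some n-vertex ordered graph saturating G has at most C edges
-- (literal unfolding of "the minimum number of edges of a saturating graph is ≤ C").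
SatLe : ∀ {m} → ℕ → OGraph m → ℕ → Set
SatLe n G C = Σ (OGraph n) λ H → Saturates H G × edgeCount H ≤ C

SatBounded : ∀ {m} → OGraph m → Set
SatBounded G = ∃[ C ] (∀ n → SatLe n G C)

-- Ordered matching from a list of edges given as pairs of 1-based labels in [m].
fromEdges : (m : ℕ) → List (ℕ × ℕ) → OGraph m
fromEdges m es = record { adj = a ; sym = s ; irrefl = ir }
  where
  open import Data.Nat using (_≡ᵇ_)
  open import Relation.Binary.PropositionalEquality using (refl; cong₂; trans)
  open import Data.Bool.Properties using (∨-comm; ∧-comm)
  hit : ℕ → ℕ → ℕ × ℕ → Bool
  hit x y (p , q) = ((x ≡ᵇ p) ∧ (y ≡ᵇ q)) ∨ ((x ≡ᵇ q) ∧ (y ≡ᵇ p))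
  anyE : ℕ → ℕ → List (ℕ × ℕ) → Bool
  anyE x y [] = false
  anyE x y (e ∷ r) = hit x y e ∨ anyE x y r
  -- irreflexivity enforced by excluding the diagonal explicitly
  a : Fin m → Fin m → Bool
  a u v = Data.Bool.not ⌊ u ≟ v ⌋ ∧ anyE (suc (toℕ u)) (suc (toℕ v)) es
  hit-sym : ∀ x y e → hit x y e ≡ hit y x e
  hit-sym x y (p , q) = trans (∨-comm ((x ≡ᵇ p) ∧ (y ≡ᵇ q)) ((x ≡ᵇ q) ∧ (y ≡ᵇ p)))
    (cong₂ _∨_ (∧-comm (x ≡ᵇ q) (y ≡ᵇ p)) (∧-comm (x ≡ᵇ p) (y ≡ᵇ q)))
  anyE-sym : ∀ x y r → anyE x y r ≡ anyE y x r
  anyE-sym x y [] = refl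
  anyE-sym x y (e ∷ r) = cong₂ _∨_ (hit-sym x y e) (anyE-sym x y r)
  neq-sym : ∀ (u v : Fin m) → ⌊ u ≟ v ⌋ ≡ ⌊ v ≟ u ⌋
  neq-sym u v with u ≟ v | v ≟ u
  ... | yes _ | yes _ = refl
  ... | no _ | no _ = refl
  ... | yes refl | no ne = Data.Empty.⊥-elim (ne refl) where import Data.Empty
  ... | no ne | yes refl = Data.Empty.⊥-elim (ne refl) where import Data.Empty
  s : ∀ u v → a u v ≡ a v u
  s u v = cong₂ _∧_ (Relation.Binary.PropositionalEquality.cong Data.Bool.not (neq-sym u v)) (anyE-sym _ _ es)
    where import Relation.Binary.PropositionalEquality
  ir : ∀ u → a u u ≡ false
  ir u with u ≟ u
  ... | yes _ = refl
  ... | no ne = Data.Empty.⊥-elim (ne refl) where import Data.Empty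

G₁ : OGraph 8
G₁ = fromEdges 8 ((1 , 3) ∷ (2 , 7) ∷ (4 , 5) ∷ (6 , 8) ∷ [])

G₂ : OGraph 10
G₂ = fromEdges 10 ((1 , 5) ∷ (2 , 3) ∷ (4 , 7) ∷ (6 , 10) ∷ (8 , 9) ∷ [])

G₃ : OGraph 10
G₃ = fromEdges 10 ((1 , 5) ∷ (2 , 3) ∷ (4 , 9) ∷ (6 , 7) ∷ (8 , 10) ∷ [])

G₄ : OGraph 10
G₄ = fromEdges 10 ((1 , 3) ∷ (2 , 7) ∷ (4 , 5) ∷ (6 , 10) ∷ (8 , 9) ∷ [])

{-# OPTIONS --safe #-}

-- It suffices to find a finite ordered graph ("core") avoiding G together with a gap between two
-- consecutive vertices such that, once isolated vertices are inserted into the gap, every added edge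
-- with an end in the gap creates a copy of G. As G has no isolated vertices, widening the gap creates
-- no copy of G, so the blown-up graph can be saturated greedily, and all edges this adds stay inside
-- the core: the number of edges is bounded independently of n. Two gap vertices already exhibit every
-- kind of edge with an end in the gap, so the forcing condition is a finite check.

module Submission where

open import Defs
import Data.Bool as Bool
open import Data.Bool using (Bool; true; false; _∨_; _∧_; if_then_else_)
open import Data.Bool.Properties using (∨-zeroʳ)
open import Data.Fin
  using (Fin; zero; suc; _<_; _≟_; _<?_; _↑ˡ_; _↑ʳ_; splitAt; combine; inject≤; finToFun; funToFin)
open import Data.Fin.Properties
  using (all?; any?; <-cmp; <-irrefl; <-asym; <-irrelevant; splitAt-↑ˡ; splitAt-↑ʳ; join-splitAt; toℕ-↑ˡ; toℕ-↑ʳ;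
         toℕ<n; combine-injective; finToFun-funToFin; inject≤-injective;
         injective⇒≤)
open import Data.List
  using (List; []; _∷_; filter; concatMap; map; _++_; allFin; cartesianProduct; lookup)
open import Data.List.Membership.Propositional using (_∈_; lose)
open import Data.List.Membership.Propositional.Properties
  using (∈-filter⁺; ∈-filter⁻; ∈-concatMap⁺; ∈-cartesianProduct⁺; ∈-allFin; ∈-lookup)
open import Data.List.Relation.Unary.All as All using (All; []; _∷_)
open import Data.List.Relation.Unary.Any as Any using (Any; here)
open import Data.List.Relation.Unary.AllPairs using (_∷_)
open import Data.List.Relation.Unary.Unique.Propositional using (Unique)
import Data.List.Relation.Unary.Unique.Propositional.Properties as Unique
open import Data.Maybe using (Maybe; just; nothing; maybe′)
open import Data.Maybe.Properties using (just-injective)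
open import Data.Nat as ℕ using (ℕ; zero; suc; _+_; _*_; _≤_; z≤n; s≤s)
open import Data.Nat.Properties as ℕ using (≤-total)
open import Data.Product using (Σ-syntax; _×_; _,_; ∃-syntax; proj₁; proj₂)
open import Data.Sum as Sum using (_⊎_; inj₁; inj₂; [_,_]′)
open import Function using (_∘_; id; const)
open import Relation.Binary using (tri<; tri≈; tri>)
open import Relation.Binary.PropositionalEquality as ≡
  using (_≡_; _≢_; refl; trans; cong; cong₂; subst; subst₂)
open import Relation.Nullary using (Irrelevant; ¬_; Dec; yes; no; contradiction)
open import Relation.Nullary.Decidable
  using (⌊_⌋; map′; _→-dec_; _×-dec_; _⊎-dec_; does; True; toWitness; dec-true; isYes≗does)

private
  variable
    a b c d k m n s t : ℕ

-- Order-preserving embeddings and added edges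

∨-true : ∀ x y → x ∨ y ≡ true → x ≡ true ⊎ y ≡ true
∨-true true  y _  = inj₁ refl
∨-true false y eq = inj₂ eq

Increasing : (Fin m → Fin n) → Set
Increasing f = ∀ u v → u < v → f u < f v

Hom : (Fin m → Fin n) → OGraph m → OGraph n → Set
Hom f G H = ∀ u v → adj G u v ≡ true → adj H (f u) (f v) ≡ true

Embeds : OGraph n → OGraph m → (Fin m → Fin n) → Set
Embeds H G φ = Increasing φ × Hom φ G H

embeds? : (H : OGraph n) (G : OGraph m) (φ : Fin m → Fin n) → Dec (Embeds H G φ)
embeds? H G φ =
  (all? λ u → all? λ v → (u <? v) →-dec (φ u <? φ v)) ×-dec
  (all? λ u → all? λ v → (adj G u v Bool.≟ true) →-dec (adj H (φ u) (φ v) Bool.≟ true))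

-- Brute force over all maps, each coded by an element of one finite type. It only lets the greedy
-- construction branch; the concrete cores are checked with `search`.
contains? : (H : OGraph n) (G : OGraph m) → Dec (Contains H G)
contains? {n} {m} H G =
  map′ (λ (i , φ-emb) → finToFun {n} {m} i , φ-emb)
       (λ (φ , mono , hom) → funToFin φ ,
          (λ u v u<v → subst₂ _<_ (≡.sym (finToFun-funToFin φ u)) (≡.sym (finToFun-funToFin φ v)) (mono u v u<v)) ,
          (λ u v uv → subst₂ (λ x y → adj H x y ≡ true)
                        (≡.sym (finToFun-funToFin φ u)) (≡.sym (finToFun-funToFin φ v)) (hom u v uv)))
       (any? (λ i → embeds? H G (finToFun {n} {m} i)))

contains-map : {H : OGraph n} {H′ : OGraph k} {G : OGraph m} (f : Fin n → Fin k) →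
  Increasing f → Hom f H H′ → Contains H G → Contains H′ G
contains-map f f-inc f-hom (φ , φ-inc , φ-hom) =
  f ∘ φ , (λ u v → f-inc _ _ ∘ φ-inc u v) , (λ u v → f-hom _ _ ∘ φ-hom u v)

contains-⊑ : {H H′ : OGraph n} {G : OGraph m} → Hom id H H′ → Contains H G → Contains H′ G
contains-⊑ {H = H} {H′} {G} = contains-map {H = H} {H′} {G} id (λ _ _ → id)

increasing-reflects : (f : Fin m → Fin n) → Increasing f → ∀ u v → f u < f v → u < v
increasing-reflects f f-inc u v fu<fv with <-cmp u v
... | tri< u<v _ _  = u<v
... | tri≈ _ refl _ = contradiction fu<fv (<-irrefl refl)
... | tri> _ _ v<u  = contradiction (f-inc v u v<u) (<-asym fu<fv)

increasing-injective : (f : Fin m → Fin n) → Increasing f → ∀ {u v} → f u ≡ f v → u ≡ v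
increasing-injective f f-inc {u} {v} eq with <-cmp u v
... | tri< u<v _ _ = contradiction (f-inc u v u<v) (<-irrefl eq)
... | tri≈ _ u≡v _ = u≡v
... | tri> _ _ v<u = contradiction (f-inc v u v<u) (<-irrefl (≡.sym eq))

adj-distinct : (H : OGraph n) {u v : Fin n} → adj H u v ≡ true → u ≢ v
adj-distinct H uv refl with trans (≡.sym uv) (irrefl H _)
... | ()

⌊⌋-true : {A : Set} (A? : Dec A) → A → ⌊ A? ⌋ ≡ true
⌊⌋-true A? x = trans (isYes≗does A?) (dec-true A? x)

both≡ : {u i v j : Fin n} → ⌊ u ≟ i ⌋ ∧ ⌊ v ≟ j ⌋ ≡ true → u ≡ i × v ≡ j
both≡ {u = u} {i} {v} {j} eq with u ≟ i | v ≟ j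
both≡ eq | yes p | yes q = p , q
both≡ () | yes p | no q
both≡ () | no p | _

addEdge-⊒ : (H : OGraph n) (i j : Fin n) (i<j : i < j) → Hom id H (addEdge H i j i<j)
addEdge-⊒ H i j i<j u v uv rewrite uv = refl

addEdge-new : (H : OGraph n) (i j : Fin n) (i<j : i < j) → adj (addEdge H i j i<j) i j ≡ true
addEdge-new H i j i<j rewrite ⌊⌋-true (i ≟ i) refl | ⌊⌋-true (j ≟ j) refl = ∨-zeroʳ (adj H i j)

-- Universal property of the added edge. The target may have the image edge already: in this way a
-- saturated graph with an edge at the gap is compared with the blow-up plus that edge.
addEdge-hom : {H : OGraph n} {H′ : OGraph k} (f : Fin n → Fin k) {i j : Fin n} (i<j : i < j) →
  Hom f H H′ → adj H′ (f i) (f j) ≡ true → Hom f (addEdge H i j i<j) H′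
addEdge-hom {H = H} {H′} f {i} {j} i<j f-hom ij u v uv with ∨-true (adj H u v) _ uv
... | inj₁ old = f-hom u v old
... | inj₂ new with ∨-true (⌊ u ≟ i ⌋ ∧ ⌊ v ≟ j ⌋) _ new
... | inj₁ e with refl , refl ← both≡ {u = u} {i} e = ij
... | inj₂ e with refl , refl ← both≡ {u = u} {j} e = trans (OGraph.sym H′ (f j) (f i)) ij

addEdge-mono : {H : OGraph n} {H′ : OGraph k} (f : Fin n → Fin k)
  {i j : Fin n} (i<j : i < j) (fi<fj : f i < f j) →
  Hom f H H′ → Hom f (addEdge H i j i<j) (addEdge H′ (f i) (f j) fi<fj)
addEdge-mono {H = H} {H′} f {i} {j} i<j fi<fj f-hom =
  addEdge-hom {H = H} {addEdge H′ (f i) (f j) fi<fj} f i<j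
    (λ u v uv → addEdge-⊒ H′ (f i) (f j) fi<fj _ _ (f-hom u v uv))
    (addEdge-new H′ (f i) (f j) fi<fj)

-- Greedy saturation

pairs : ∀ n → List (Fin n × Fin n)
pairs n = concatMap (λ u → map (u ,_) (allFin n)) (allFin n)

concatMap-pairs : {A B : Set} (xs : List A) (ys : List B) →
  concatMap (λ x → map (x ,_) ys) xs ≡ cartesianProduct xs ys
concatMap-pairs []       ys = refl
concatMap-pairs (x ∷ xs) ys = cong (map (x ,_) ys ++_) (concatMap-pairs xs ys)

∈-pairs : (u v : Fin n) → (u , v) ∈ pairs n
∈-pairs {n} u v = subst (_ ∈_) (≡.sym (concatMap-pairs (allFin n) (allFin n))) (∈-cartesianProduct⁺ (∈-allFin u) (∈-allFin v))

Settled : OGraph n → OGraph m → Fin n × Fin n → Set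
Settled H G (i , j) = (i<j : i < j) → adj H i j ≡ true ⊎ Contains (addEdge H i j i<j) G

-- One pass over the pairs is enough: a present edge stays present, and a copy of `G` created by
-- adding a pair survives when further edges are added. So each verdict, reached for an intermediate
-- graph, still holds for the final one.
settle : (G : OGraph m) (ps : List (Fin n × Fin n)) (H : OGraph n) → Avoids H G →
  ∃[ H′ ] Hom id H H′ × Avoids H′ G × All (Settled H′ G) ps
settle G [] H avoids = H , (λ _ _ → id) , avoids , []
settle G ((i , j) ∷ ps) H avoids with i <? j
... | no i≮j =
  let H′ , H⊑H′ , avoids′ , settled = settle G ps H avoids
  in H′ , H⊑H′ , avoids′ , (λ i<j → contradiction i<j i≮j) ∷ settled
... | yes i<j with contains? (addEdge H i j i<j) G
... | yes contains =
  let H′ , H⊑H′ , avoids′ , settled = settle G ps H avoids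
  in H′ , H⊑H′ , avoids′ ,
     (λ i<j′ → inj₂ (contains-⊑ {H = addEdge H i j i<j} {addEdge H′ i j i<j′} {G}
                       (addEdge-mono {H = H} {H′} id i<j i<j′ H⊑H′) contains)) ∷ settled
... | no ¬contains =
  let H′ , H⊑H′ , avoids′ , settled = settle G ps (addEdge H i j i<j) ¬contains
  in H′ , (λ u v uv → H⊑H′ u v (addEdge-⊒ H i j i<j u v uv)) , avoids′ ,
     (λ _ → inj₁ (H⊑H′ i j (addEdge-new H i j i<j))) ∷ settled

saturate : (G : OGraph m) (H : OGraph n) → Avoids H G → ∃[ H′ ] Hom id H H′ × Saturates H′ G
saturate {n = n} G H avoids =
  let H′ , H⊑H′ , avoids′ , settled = settle G (pairs n) H avoids
  in H′ , H⊑H′ , avoids′ , λ i j i<j non →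
     [ (λ ij → contradiction (trans (≡.sym non) ij) λ ()) , id ]′ (All.lookup settled (∈-pairs i j) i<j)

-- Counting edges

isEdge? : (H : OGraph n) (p : Fin n × Fin n) → Dec (adj H (proj₁ p) (proj₂ p) ∧ ⌊ proj₁ p <? proj₂ p ⌋ ≡ true)
isEdge? H p = (adj H (proj₁ p) (proj₂ p) ∧ ⌊ proj₁ p <? proj₂ p ⌋) Bool.≟ true

-- Filters the same list by the same test as `edgeCount`, so that `edgeCount H` is the length of
-- `edges H` by definition.
edges : OGraph n → List (Fin n × Fin n)
edges {n} H = filter (isEdge? H) (pairs n)

∈-edges⁺ : (H : OGraph n) {u v : Fin n} → adj H u v ≡ true → u < v → (u , v) ∈ edges H
∈-edges⁺ H {u} {v} uv u<v =
  ∈-filter⁺ (isEdge? H) (∈-pairs u v) (cong₂ _∧_ uv (⌊⌋-true (u <? v) u<v))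

∈-edges⁻ : (H : OGraph n) {u v : Fin n} → (u , v) ∈ edges H → adj H u v ≡ true × u < v
∈-edges⁻ {n} H {u} {v} e with adj H u v | u <? v | proj₂ (∈-filter⁻ (isEdge? H) {xs = pairs n} e)
... | true | yes u<v | _ = refl , u<v

edges-unique : (H : OGraph n) → Unique (edges H)
edges-unique {n} H = Unique.filter⁺ (isEdge? H)
  (subst Unique (≡.sym (concatMap-pairs (allFin n) (allFin n))) (Unique.cartesianProduct⁺ (Unique.allFin⁺ n) (Unique.allFin⁺ n)))

lookup-injective : {A : Set} {xs : List A} → Unique xs → ∀ {i j} → lookup xs i ≡ lookup xs j → i ≡ j
lookup-injective (_  ∷ _)  {zero}  {zero}  _  = refl
lookup-injective (x∉ ∷ _)  {zero}  {suc j} eq = contradiction eq (All.lookup x∉ (∈-lookup j))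
lookup-injective (x∉ ∷ _)  {suc i} {zero}  eq = contradiction (≡.sym eq) (All.lookup x∉ (∈-lookup i))
lookup-injective (_  ∷ us) {suc i} {suc j} eq = cong suc (lookup-injective us eq)

-- An edge is coded by the pair of `f`-images of its ends. Only ends of edges occur, so injectivity
-- is asked of non-isolated vertices alone; `u′` and `v′` are the neighbours that witness this.
edgeCount-bound : (H : OGraph n) (f : Fin n → Fin k) →
  (∀ {u u′ v v′} → adj H u u′ ≡ true → adj H v v′ ≡ true → f u ≡ f v → u ≡ v) →
  edgeCount H ≤ k * k
edgeCount-bound H f f-inj = injective⇒≤ {f = code} λ {i} {j} eq →
  lookup-injective (edges-unique H) (code-injective i j eq)
  where
  code : Fin (edgeCount H) → Fin _
  code i = let u , v = lookup (edges H) i in combine (f u) (f v)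
  code-injective : ∀ i j → code i ≡ code j → lookup (edges H) i ≡ lookup (edges H) j
  code-injective i j eq =
    let u , v   = lookup (edges H) i
        u′ , v′ = lookup (edges H) j
        fu≡ , fv≡ = combine-injective (f u) (f v) (f u′) (f v′) eq
        uv  = proj₁ (∈-edges⁻ H (∈-lookup i))
        uv′ = proj₁ (∈-edges⁻ H (∈-lookup j))
    in cong₂ _,_ (f-inj uv uv′ fu≡)
         -- `f-inj` takes the vertex in question as the first end, so both edges are reversed to
         -- treat the second ends.
         (f-inj (trans (OGraph.sym H v u) uv) (trans (OGraph.sym H v′ u′) uv′) fv≡)

-- Blowing up the gap

↑ˡ-mono : {i j : Fin m} (n : ℕ) → i < j → i ↑ˡ n < j ↑ˡ n
↑ˡ-mono {i = i} {j} n = subst₂ ℕ._<_ (≡.sym (toℕ-↑ˡ i n)) (≡.sym (toℕ-↑ˡ j n))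

↑ˡ-cancel : {i j : Fin m} (n : ℕ) → i ↑ˡ n < j ↑ˡ n → i < j
↑ˡ-cancel {i = i} {j} n = subst₂ ℕ._<_ (toℕ-↑ˡ i n) (toℕ-↑ˡ j n)

↑ʳ-mono : {i j : Fin m} (n : ℕ) → i < j → n ↑ʳ i < n ↑ʳ j
↑ʳ-mono {i = i} {j} n i<j =
  subst₂ ℕ._<_ (≡.sym (toℕ-↑ʳ n i)) (≡.sym (toℕ-↑ʳ n j)) (ℕ.+-monoʳ-< n i<j)

↑ʳ-cancel : {i j : Fin m} (n : ℕ) → n ↑ʳ i < n ↑ʳ j → i < j
↑ʳ-cancel {i = i} {j} n lt = ℕ.+-cancelˡ-< n _ _ (subst₂ ℕ._<_ (toℕ-↑ʳ n i) (toℕ-↑ʳ n j) lt)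

↑ˡ<↑ʳ : (i : Fin m) (j : Fin n) → i ↑ˡ n < m ↑ʳ j
↑ˡ<↑ʳ {m} {n} i j = subst₂ ℕ._<_ (≡.sym (toℕ-↑ˡ i n)) (≡.sym (toℕ-↑ʳ m j)) (ℕ.<-≤-trans (toℕ<n i) (ℕ.m≤m+n m _))

data Sides (m n : ℕ) : Fin (m + n) → Set where
  onLeft  : (i : Fin m) → Sides m n (i ↑ˡ n)
  onRight : (j : Fin n) → Sides m n (m ↑ʳ j)

sides : ∀ m {n} (x : Fin (m + n)) → Sides m n x
sides m {n} x with splitAt m x | join-splitAt m n x
... | inj₁ i | refl = onLeft i
... | inj₂ j | refl = onRight j

_⊞_ : (Fin a → Fin b) → (Fin c → Fin d) → Fin (a + c) → Fin (b + d)
_⊞_ {a} {b} {c} {d} f g x = [ (λ i → f i ↑ˡ d) , (λ j → b ↑ʳ g j) ]′ (splitAt a x)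

⊞-↑ˡ : (f : Fin a → Fin b) (g : Fin c → Fin d) (i : Fin a) → (f ⊞ g) (i ↑ˡ c) ≡ f i ↑ˡ d
⊞-↑ˡ {a} {c = c} f g i rewrite splitAt-↑ˡ a i c = refl

⊞-↑ʳ : (f : Fin a → Fin b) (g : Fin c → Fin d) (j : Fin c) → (f ⊞ g) (a ↑ʳ j) ≡ b ↑ʳ g j
⊞-↑ʳ {a} {c = c} f g j rewrite splitAt-↑ʳ a c j = refl

⊞-increasing : (f : Fin a → Fin b) (g : Fin c → Fin d) →
  Increasing f → Increasing g → Increasing (f ⊞ g)
⊞-increasing {a} {b} {c} {d} f g f-inc g-inc u v u<v with sides a u | sides a v
... | onLeft i  | onLeft j
  rewrite ⊞-↑ˡ f g i | ⊞-↑ˡ f g j = ↑ˡ-mono d (f-inc i j (↑ˡ-cancel c u<v))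
... | onLeft i  | onRight j
  rewrite ⊞-↑ˡ f g i | ⊞-↑ʳ f g j = ↑ˡ<↑ʳ (f i) (g j)
... | onRight i | onLeft j  = contradiction u<v (<-asym (↑ˡ<↑ʳ j i))
... | onRight i | onRight j
  rewrite ⊞-↑ʳ f g i | ⊞-↑ʳ f g j = ↑ʳ-mono b (g-inc i j (↑ʳ-cancel a u<v))

pick : Fin n → Fin n → Fin 2 → Fin n
pick c d zero    = c
pick c d (suc _) = d

pick-increasing : {c d : Fin n} → c < d → Increasing (pick c d)
pick-increasing c<d zero       (suc zero) _ = c<d
pick-increasing c<d (suc zero) (suc zero) 1<1 = contradiction 1<1 (ℕ.<-irrefl refl)

-- Two slots suffice for any two gap vertices. If `c` and `d` coincide, the other slot still needs a
-- different value: `suc zero` when `c` is `zero`, and `zero` otherwise. Hence the target must have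
-- at least two points.
cover : (c d : Fin (2 + n)) → Σ[ g ∈ (Fin 2 → Fin (2 + n)) ] Increasing g × ∃[ i ] ∃[ j ] g i ≡ c × g j ≡ d
cover c d with <-cmp c d
... | tri< c<d _ _ = pick c d , pick-increasing c<d , zero , suc zero , refl , refl
... | tri> _ _ d<c = pick d c , pick-increasing d<c , suc zero , zero , refl , refl
cover zero    _ | tri≈ _ refl _ = pick zero (suc zero) , pick-increasing (s≤s z≤n) , zero , zero , refl , refl
cover (suc c) _ | tri≈ _ refl _ = pick zero (suc c) , pick-increasing (s≤s z≤n) , suc zero , suc zero , refl , refl

NoIsolated : OGraph m → Set
NoIsolated G = ∀ u → ∃[ v ] adj G u v ≡ true

module BlowUp (L R : ℕ) (H₀ : OGraph (L + R)) where

  core : ∀ t → Fin (L + R) → Fin (L + (t + R))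
  core t = id {A = Fin L} ⊞ (t ↑ʳ_)

  core-↑ˡ : ∀ t i → core t (i ↑ˡ R) ≡ i ↑ˡ (t + R)
  core-↑ˡ t = ⊞-↑ˡ (id {A = Fin L}) (t ↑ʳ_)

  core-↑ʳ : ∀ t j → core t (L ↑ʳ j) ≡ L ↑ʳ (t ↑ʳ j)
  core-↑ʳ t = ⊞-↑ʳ (id {A = Fin L}) (t ↑ʳ_)

  gap : Fin t → Fin (L + (t + R))
  gap g = L ↑ʳ (g ↑ˡ R)

  core-increasing : ∀ t → Increasing (core t)
  core-increasing t = ⊞-increasing (id {A = Fin L}) (t ↑ʳ_) (λ _ _ → id) (λ _ _ → ↑ʳ-mono t)

  -- Partial inverse of `core t`, undefined on the gap. Adjacency in the blow-up is pulled back
  -- along it, which makes the gap vertices isolated.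
  retract : ∀ t → Fin (L + (t + R)) → Maybe (Fin (L + R))
  retract t x = [ just ∘ (_↑ˡ R) , [ const nothing , just ∘ (L ↑ʳ_) ]′ ∘ splitAt t ]′ (splitAt L x)

  retract-core : ∀ t i → retract t (core t i) ≡ just i
  retract-core t i with sides L i
  ... | onLeft j rewrite core-↑ˡ t j | splitAt-↑ˡ L j (t + R) = refl
  ... | onRight j rewrite core-↑ʳ t j | splitAt-↑ʳ L (t + R) (t ↑ʳ j) | splitAt-↑ʳ t R j = refl

  retract-gap : (g : Fin t) → retract t (gap g) ≡ nothing
  retract-gap {t} g rewrite splitAt-↑ʳ L (t + R) (g ↑ˡ R) | splitAt-↑ˡ t g R = refl

  data Place (t : ℕ) : Fin (L + (t + R)) → Set where
    onCore : ∀ i → Place t (core t i)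
    onGap  : ∀ g → Place t (gap g)

  place : ∀ t x → Place t x
  place t x with sides L x
  ... | onLeft i = subst (Place t) (core-↑ˡ t i) (onCore (i ↑ˡ R))
  ... | onRight y with sides t y
  ... | onLeft g = onGap g
  ... | onRight j = subst (Place t) (core-↑ʳ t j) (onCore (L ↑ʳ j))

  retract⁻¹ : ∀ t x {i} → retract t x ≡ just i → core t i ≡ x
  retract⁻¹ t x eq with place t x
  ... | onCore i = cong (core t) (just-injective (trans (≡.sym eq) (retract-core t i)))
  ... | onGap g with () ← trans (≡.sym eq) (retract-gap g)

  linked : Maybe (Fin (L + R)) → Maybe (Fin (L + R)) → Bool
  linked (just i) (just j) = adj H₀ i j
  linked (just _) nothing  = false
  linked nothing  _        = false

  linked-sym : ∀ p q → linked p q ≡ linked q p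
  linked-sym (just i) (just j) = OGraph.sym H₀ i j
  linked-sym (just _) nothing  = refl
  linked-sym nothing  (just _) = refl
  linked-sym nothing  nothing  = refl

  linked-irrefl : ∀ p → linked p p ≡ false
  linked-irrefl (just i) = irrefl H₀ i
  linked-irrefl nothing  = refl

  linked⇒just : ∀ p q → linked p q ≡ true → ∃[ i ] p ≡ just i
  linked⇒just (just i) _ _ = i , refl

  blowUp : ∀ t → OGraph (L + (t + R))
  blowUp t = record
    { adj    = λ x y → linked (retract t x) (retract t y)
    ; sym    = λ x y → linked-sym (retract t x) (retract t y)
    ; irrefl = λ x → linked-irrefl (retract t x)
    }

  stretch : (Fin s → Fin t) → Fin (L + (s + R)) → Fin (L + (t + R))
  stretch g = id {A = Fin L} ⊞ (g ⊞ id {A = Fin R})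

  stretch-increasing : (g : Fin s → Fin t) → Increasing g → Increasing (stretch g)
  stretch-increasing g g-inc =
    ⊞-increasing (id {A = Fin L}) (g ⊞ id {A = Fin R}) (λ _ _ → id)
      (⊞-increasing g (id {A = Fin R}) g-inc (λ _ _ → id))

  stretch-core : (g : Fin s → Fin t) (i : Fin (L + R)) → stretch g (core s i) ≡ core t i
  stretch-core {s} {t} g i with sides L i
  ... | onLeft j
    rewrite core-↑ˡ s j | core-↑ˡ t j = ⊞-↑ˡ (id {A = Fin L}) (g ⊞ id {A = Fin R}) j
  ... | onRight j
    rewrite core-↑ʳ s j | core-↑ʳ t j | ⊞-↑ʳ (id {A = Fin L}) (g ⊞ id {A = Fin R}) (s ↑ʳ j) =
      cong (L ↑ʳ_) (⊞-↑ʳ g (id {A = Fin R}) j)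

  stretch-gap : (g : Fin s → Fin t) (i : Fin s) → stretch g (gap i) ≡ gap (g i)
  stretch-gap g i = trans (⊞-↑ʳ (id {A = Fin L}) (g ⊞ id {A = Fin R}) (i ↑ˡ R)) (cong (L ↑ʳ_) (⊞-↑ˡ g (id {A = Fin R}) i))

  -- Adjacency in the blow-up and membership in the gap are both defined through `retract`, so this
  -- makes both invariant under stretching.
  retract-stretch : (g : Fin s → Fin t) (x : Fin (L + (s + R))) → retract t (stretch g x) ≡ retract s x
  retract-stretch {s} {t} g x with place s x
  ... | onCore i rewrite stretch-core g i | retract-core s i = retract-core t i
  ... | onGap i rewrite stretch-gap g i | retract-gap i = retract-gap (g i)

  stretch-hom : (g : Fin s → Fin t) → Hom (stretch g) (blowUp s) (blowUp t)
  stretch-hom g u v uv rewrite retract-stretch g u | retract-stretch g v = uv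

  -- Every stretch carries core vertices to the corresponding core vertices, so only the gap
  -- vertices among `u` and `v` constrain `g`.
  stretch-onto : (u v : Fin (L + ((2 + t) + R))) →
    Σ[ g ∈ (Fin 2 → Fin (2 + t)) ] Increasing g × ∃[ x ] ∃[ y ] stretch g x ≡ u × stretch g y ≡ v
  stretch-onto {t} u v with place (2 + t) u | place (2 + t) v
  ... | onCore i | onCore j =
    -- No gap vertex is involved, so any increasing `g` will do.
    let g , g-inc , _ = cover zero zero in g , g-inc , core 2 i , core 2 j , stretch-core g i , stretch-core g j
  ... | onCore i | onGap d =
    let g , g-inc , _ , y , _ , gy = cover zero d
    in g , g-inc , core 2 i , gap y , stretch-core g i , trans (stretch-gap g y) (cong gap gy)
  ... | onGap c | onCore j =
    let g , g-inc , x , _ , gx , _ = cover c zero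
    in g , g-inc , gap x , core 2 j , trans (stretch-gap g x) (cong gap gx) , stretch-core g j
  ... | onGap c | onGap d =
    let g , g-inc , x , y , gx , gy = cover c d
    in g , g-inc , gap x , gap y , trans (stretch-gap g x) (cong gap gx) , trans (stretch-gap g y) (cong gap gy)

  InGap : ∀ t → Fin (L + (t + R)) → Set
  InGap t x = retract t x ≡ nothing

  Forcing : OGraph m → ℕ → Set
  Forcing G t = ∀ x y (x<y : x < y) → InGap t x ⊎ InGap t y → Contains (addEdge (blowUp t) x y x<y) G

  -- The added edge is pulled back to the blow-up with two gap vertices; the copy of `G` found there
  -- is pushed forward along the stretch.
  forcing-stretch : {G : OGraph m} → Forcing G 2 → Forcing G (2 + t)
  forcing-stretch {t = t} {G} forcing u v u<v inGap with stretch-onto {t} u v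
  ... | g , g-inc , x , y , refl , refl =
    contains-map {H = addEdge (blowUp 2) x y x<y} {addEdge (blowUp (2 + t)) (stretch g x) (stretch g y) u<v} {G}
      (stretch g) (stretch-increasing g g-inc)
      (addEdge-mono {H = blowUp 2} {blowUp (2 + t)} (stretch g) x<y u<v (stretch-hom g))
      (forcing x y x<y (Sum.map (trans (≡.sym (retract-stretch g x))) (trans (≡.sym (retract-stretch g y))) inGap))
    where
    x<y : x < y
    x<y = increasing-reflects (stretch g) (stretch-increasing g g-inc) x y u<v

  -- Saturated graphs from a core with a forcing gap

  module _ {G : OGraph (suc m)} (noIsolated : NoIsolated G)
           (avoids : Avoids H₀ G) (forcing : Forcing G 2) where

    -- Every vertex of a copy of `G` has a neighbour in that copy and so lies outside the gap;
    -- retracting the copy gives one in `H₀`.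
    blowUp-avoids : ∀ t → Avoids (blowUp t) G
    blowUp-avoids t (φ , φ-inc , φ-hom) = avoids (ψ , ψ-inc , ψ-hom)
      where
      inCore : ∀ u → ∃[ i ] retract t (φ u) ≡ just i
      inCore u = let v , uv = noIsolated u in linked⇒just (retract t (φ u)) (retract t (φ v)) (φ-hom u v uv)
      ψ : Fin (suc _) → Fin (L + R)
      ψ = proj₁ ∘ inCore
      φ≡core : ∀ u → core t (ψ u) ≡ φ u
      φ≡core u = retract⁻¹ t (φ u) (proj₂ (inCore u))
      ψ-inc : Increasing ψ
      ψ-inc u v u<v = increasing-reflects (core t) (core-increasing t) _ _
        (subst₂ _<_ (≡.sym (φ≡core u)) (≡.sym (φ≡core v)) (φ-inc u v u<v))
      ψ-hom : Hom ψ G H₀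
      ψ-hom u v uv = subst₂ (λ p q → linked p q ≡ true) (proj₂ (inCore u)) (proj₂ (inCore v)) (φ-hom u v uv)

    -- The number of vertices of the blow-up with two gap vertices. It separates small from large
    -- `n`, and its square is the edge bound in both cases.
    order : ℕ
    order = L + (2 + R)

    satLe-blowUp : ∀ t → SatLe (L + ((2 + t) + R)) G (order * order)
    satLe-blowUp t = H′ , saturates , edgeCount-bound H′ f f-injective
      where
      B = blowUp (2 + t)
      saturated = saturate G B (blowUp-avoids (2 + t))
      H′ = proj₁ saturated
      B⊑H′ = proj₁ (proj₂ saturated)
      saturates = proj₂ (proj₂ saturated)

      -- With such an edge, `H′` would contain the blow-up plus that edge, hence a copy of `G` by
      -- forcing.
      edge-avoids-gap : ∀ u v → adj H′ u v ≡ true → u < v → ¬ (InGap (2 + t) u ⊎ InGap (2 + t) v)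
      edge-avoids-gap u v uv u<v inGap = proj₁ saturates
        (contains-⊑ {H = addEdge B u v u<v} {H′} {G} (addEdge-hom {H = B} {H′} id u<v B⊑H′ uv)
          (forcing-stretch {t = t} {G} forcing u v u<v inGap))

      edge-in-core : ∀ u v → adj H′ u v ≡ true → ∃[ i ] retract (2 + t) u ≡ just i
      edge-in-core u v uv with retract (2 + t) u in eq | <-cmp u v
      ... | just i  | _ = i , refl
      ... | nothing | tri< u<v _ _ = contradiction (inj₁ eq) (edge-avoids-gap u v uv u<v)
      ... | nothing | tri≈ _ u≡v _ = contradiction u≡v (adj-distinct H′ uv)
      ... | nothing | tri> _ _ v<u =
        contradiction (inj₂ eq) (edge-avoids-gap v u (trans (OGraph.sym H′ v u) uv) v<u)

      -- The whole gap goes to one arbitrary vertex. No edge of `H′` meets the gap, so `f` is still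
      -- injective on the ends of edges.
      f : Fin (L + ((2 + t) + R)) → Fin order
      f x = maybe′ (core 2) (gap zero) (retract (2 + t) x)

      f-injective : ∀ {u u′ v v′} → adj H′ u u′ ≡ true → adj H′ v v′ ≡ true → f u ≡ f v → u ≡ v
      f-injective {u} {u′} {v} {v′} uu′ vv′ eq
        with i , ri ← edge-in-core u u′ uu′ | j , rj ← edge-in-core v v′ vv′
        rewrite ri | rj =
          trans (≡.sym (retract⁻¹ (2 + t) u ri))
            (trans (cong (core (2 + t)) (increasing-injective (core 2) (core-increasing 2) eq))
                   (retract⁻¹ (2 + t) v rj))

    edgeless : ∀ n → OGraph n
    edgeless n = record { adj = λ _ _ → false ; sym = λ _ _ → refl ; irrefl = λ _ → refl }

    -- On at most `order` vertices every graph meets the bound, so any saturated graph will do. The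
    -- edgeless graph is a valid start because vertex `zero` of `G` has a neighbour.
    satLe-small : n ≤ order → SatLe n G (order * order)
    satLe-small {n} n≤order =
      let H , _ , saturates = saturate G (edgeless n) edgeless-avoids
      in H , saturates , edgeCount-bound H (λ x → inject≤ x n≤order) (λ _ _ → inject≤-injective _ _ _ _)
      where
      edgeless-avoids : Avoids (edgeless n) G
      edgeless-avoids (φ , _ , φ-hom) with () ← φ-hom zero _ (proj₂ (noIsolated zero))

    satBounded : SatBounded G
    satBounded = order * order , λ n → [ satLe-small , large n ]′ (≤-total n order)
      where
      regroup : ∀ t → L + ((2 + t) + R) ≡ order + t
      regroup t = trans (cong (λ x → L + suc (suc x)) (ℕ.+-comm t R)) (≡.sym (ℕ.+-assoc L (2 + R) t))
      large : ∀ n → order ≤ n → SatLe n G (order * order)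
      -- The gap gets `2 + (n ∸ order)` vertices, since two of them are already counted in `order`.
      large n order≤n = subst (λ k → SatLe k G (order * order))
        (trans (regroup (n ℕ.∸ order)) (ℕ.m+[n∸m]≡n order≤n)) (satLe-blowUp (n ℕ.∸ order))

-- Search for embeddings

Compatible : Fin m × Fin n → Fin m × Fin n → Set
Compatible (u , x) (v , y) = (u < v → x < y) × (v < u → y < x)

compatible? : (p q : Fin m × Fin n) → Dec (Compatible p q)
compatible? (u , x) (v , y) = ((u <? v) →-dec (x <? y)) ×-dec ((v <? u) →-dec (y <? x))

Fits : List (Fin m × Fin n) → Fin m × Fin m → Fin n × Fin n → Set
Fits σ (u , v) (x , y) = All (Compatible (u , x)) σ × All (Compatible (v , y)) σ

fits? : (σ : List (Fin m × Fin n)) (e : Fin m × Fin m) (e′ : Fin n × Fin n) → Dec (Fits σ e e′)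
fits? σ (u , v) (x , y) = All.all? (compatible? (u , x)) σ ×-dec All.all? (compatible? (v , y)) σ

-- Backtracks over edges of the pattern rather than its vertices, so that only pairs from `E` are
-- tried as images.
search : List (Fin m × Fin m) → List (Fin n × Fin n) → List (Fin m × Fin n) → List (List (Fin m × Fin n))
search []             E σ = σ ∷ []
search ((u , v) ∷ es) E σ =
  concatMap (λ (x , y) → search es E ((u , x) ∷ (v , y) ∷ σ)) (filter (fits? σ (u , v)) E)

-- The branch that follows `φ` passes every filter because `φ` is increasing; the invariant is that
-- `σ` agrees with `φ`. An empty result therefore certifies avoidance.
search-complete : {φ : Fin m → Fin n} {E : List (Fin n × Fin n)} → Increasing φ →
  ∀ es σ → All (λ (u , v) → (φ u , φ v) ∈ E) es → All (λ (u , x) → φ u ≡ x) σ →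
  ∃[ τ ] τ ∈ search es E σ
search-complete φ-inc [] σ _ _ = σ , here refl
search-complete {φ = φ} {E} φ-inc ((u , v) ∷ es) σ (uv∈E ∷ es⊆E) σ≡φ =
  let τ , τ∈ = search-complete φ-inc es ((u , φ u) ∷ (v , φ v) ∷ σ) es⊆E (refl ∷ refl ∷ σ≡φ)
  in τ , ∈-concatMap⁺ (λ (x , y) → search es E ((u , x) ∷ (v , y) ∷ σ))
           (lose (∈-filter⁺ (fits? σ (u , v)) uv∈E (fits u , fits v)) τ∈)
  where
  fits : ∀ w → All (Compatible (w , φ w)) σ
  fits w = All.map (λ { {z , _} refl → φ-inc w z , φ-inc z w }) σ≡φ

search-avoids : (H : OGraph n) (G : OGraph m) → search (edges G) (edges H) [] ≡ [] → Avoids H G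
search-avoids H G none (φ , φ-inc , φ-hom)
  with τ , τ∈ ← search-complete {E = edges H} φ-inc (edges G) []
         (All.tabulate λ {(u , v)} uv → let adj-uv , u<v = ∈-edges⁻ G uv in
            ∈-edges⁺ H (φ-hom u v adj-uv) (φ-inc u v u<v)) []
  with () ← subst (τ ∈_) none τ∈

-- The first argument is a junk value for vertices missing from the assignment.
valueAt : Fin n → List (Fin m × Fin n) → Fin m → Fin n
valueAt x []            u = x
valueAt x ((v , y) ∷ σ) u = if does (u ≟ v) then y else valueAt x σ u

-- Deciding the conditions on a core

noIsolated? : (G : OGraph m) → Dec (NoIsolated G)
noIsolated? G = all? λ u → any? λ v → adj G u v Bool.≟ true

-- By irrelevance, deciding `P` at a single proof of `A` settles it at all of them. This allows
-- quantifying over proofs of `x < y`.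
Π-dec : {A : Set} {P : A → Set} → Irrelevant A → Dec A → (∀ x → Dec (P x)) → Dec (∀ x → P x)
Π-dec irr (no ¬x) P? = yes λ x → contradiction x ¬x
Π-dec {P = P} irr (yes x) P? = map′ (λ p y → subst P (irr x y) p) (λ p → p x) (P? x)

module _ (L R : ℕ) (H₀ : OGraph (L + R)) (G : OGraph (suc m)) where
  open BlowUp L R H₀

  inGap? : ∀ t x → Dec (InGap t x)
  inGap? t x with retract t x
  ... | just _  = no λ ()
  ... | nothing = yes refl

  -- The new edge joins the list of target edges. Each assignment returned is checked afresh to be
  -- an embedding, so success is sound for any list `E`.
  Found : List (Fin (L + (2 + R)) × Fin (L + (2 + R))) → (x y : Fin (L + (2 + R))) → x < y → Set
  Found E x y x<y =
    Any (λ σ → Embeds (addEdge (blowUp 2) x y x<y) G (valueAt x σ)) (search (edges G) ((x , y) ∷ E) [])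

  found? : ∀ E → Dec (∀ x y x<y → InGap 2 x ⊎ InGap 2 y → Found E x y x<y)
  found? E = all? λ x → all? λ y → Π-dec <-irrelevant (x <? y) λ x<y →
    (inGap? 2 x ⊎-dec inGap? 2 y) →-dec
    Any.any? (λ σ → embeds? (addEdge (blowUp 2) x y x<y) G (valueAt x σ)) (search (edges G) ((x , y) ∷ E) [])

  satBounded-by-search : True (noIsolated? G) → search (edges G) (edges H₀) [] ≡ [] →
    True (found? (edges (blowUp 2))) → SatBounded G
  satBounded-by-search noIsolated none found =
    satBounded {G = G} (toWitness noIsolated) (search-avoids H₀ G none)
      λ x y x<y inGap → let σ , emb = Any.satisfied (toWitness found x y x<y inGap) in valueAt x σ , emb

-- The four cores come from a SAT search followed by greedy edge deletion; core₄ is core₃ reversed.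
-- Their gaps follow the vertices 5, 7, 10 and 5, respectively.

core₁ : OGraph 10
core₁ = fromEdges 10 (
  (1 , 3) ∷ (2 , 4) ∷ (2 , 6) ∷ (3 , 8) ∷ (4 , 5) ∷ (5 , 9) ∷ (6 , 7) ∷ (7 , 9) ∷
  (8 , 10) ∷ [])

core₂ : OGraph 14
core₂ = fromEdges 14 (
  (1 , 5) ∷ (1 , 6) ∷ (2 , 3) ∷ (4 , 6) ∷ (4 , 7) ∷ (4 , 8) ∷ (5 , 7) ∷ (5 , 9) ∷
  (6 , 10) ∷ (7 , 11) ∷ (8 , 10) ∷ (8 , 11) ∷ (9 , 11) ∷ (9 , 14) ∷ (10 , 14) ∷ (12 , 13) ∷ [])

core₃ : OGraph 15
core₃ = fromEdges 15 (
  (1 , 5) ∷ (1 , 9) ∷ (2 , 3) ∷ (4 , 8) ∷ (4 , 10) ∷ (5 , 6) ∷ (6 , 7) ∷ (6 , 13) ∷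
  (7 , 11) ∷ (8 , 9) ∷ (9 , 10) ∷ (10 , 14) ∷ (11 , 12) ∷ (12 , 14) ∷ (13 , 15) ∷ [])

core₄ : OGraph 15
core₄ = fromEdges 15 (
  (1 , 3) ∷ (2 , 4) ∷ (2 , 6) ∷ (3 , 10) ∷ (4 , 5) ∷ (5 , 9) ∷ (6 , 7) ∷ (6 , 12) ∷
  (7 , 8) ∷ (7 , 15) ∷ (8 , 12) ∷ (9 , 10) ∷ (10 , 11) ∷ (11 , 15) ∷ (13 , 14) ∷ [])

theorem4 : SatBounded G₁ × SatBounded G₂ × SatBounded G₃ × SatBounded G₄
theorem4 =
  -- The numbers count the core vertices before and after the gap. Each `refl` is an exhausted
  -- search for `G` in the core, and each `_` a decision that evaluates to a positive answer.
  satBounded-by-search 5 5 core₁ G₁ _ refl _ ,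
  satBounded-by-search 7 7 core₂ G₂ _ refl _ ,
  satBounded-by-search 10 5 core₃ G₃ _ refl _ ,
  -- `G₄` is `G₃` with the order reversed, so the two sides of the gap change places.
  satBounded-by-search 5 10 core₄ G₄ _ refl _
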